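{- Let $\mathbb{P}$ be a small category, $J\colon\mathbb{P}\to\mathbb{M}$ a functor and $f\colon X\to Y$ a morphism of $\mathbb{M}$. Then $f$ is $J$-open if and only if $f$ is $(\mathbb{P},|\mathbb{P}|)$-open.
   Context: Generalized open map situation: a category $\mathbb{M}$, a set $V$ with a function $J\colon V\to\mathrm{ob}(\mathbb{M})$, two small categories $\mathbb{E}$ and $\mathbb{S}$ both with object set $V$, and functors $J_{\mathbb{E}}\colon\mathbb{E}\to\mathbb{M}$, $J_{\mathbb{S}}\colon\mathbb{S}\to\mathbb{M}$ that coincide with $J$ on objects. A morphism $f\colon X\to Y$ of $\mathbb{M}$ is $(\mathbb{E},\mathbb{S})$-open if for every $e\colon v\to w$ in $\mathbb{E}$ and all $x\colon Jv\to X$, $y\colon Jw\to Y$ in $\mathbb{M}$ with $y\circ J_{\mathbb{E}}e=f\circ x$ there are $u\in V$, $e'\colon v\to u$ in $\mathbb{E}$, $s\colon u\to w$ in $\mathbb{S}$ and $x'\colon Ju\to X$ in $\mathbb{M}$ with $J_{\mathbb{S}}s\circ J_{\mathbb{E}}e'=J_{\mathbb{E}}e$, $x'\circ J_{\mathbb{E}}e'=x$ and $f\circ x'=y\circ J_{\mathbb{S}}s$. For a functor $J\colon\mathbb{P}\to\mathbb{M}$, $f\colon X\to Y$ is $J$-open if for every $e\colon v\to w$ in $\mathbb{P}$ and all $r\colon Jv\to X$, $s\colon Jw\to Y$ with $s\circ Je=f\circ r$ there is $d\colon Jw\to X$ with $f\circ d=s$ and $d\circ Je=r$. $|\mathbb{P}|$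 is the discrete category with the same objects as $\mathbb{P}$. "$(\mathbb{P},|\mathbb{P}|)$-open" refers to the generalized open map situation with $V=\mathrm{ob}(\mathbb{P})$, $\mathbb{E}=\mathbb{P}$, $J_{\mathbb{E}}=J$, $\mathbb{S}=|\mathbb{P}|$, and $J_{\mathbb{S}}$ the unique functor agreeing with $J$ on objects. -}

module Defs where

open import Level using (Level; _⊔_; suc)
open import Data.Product using (Σ-syntax; _×_)
open import Relation.Binary.Structures using (IsEquivalence)
open import Relation.Binary.PropositionalEquality
  using (_≡_; refl; trans; cong₂; isEquivalence)

-- Hom-sets are setoids: equality of parallel morphisms is _≈_.  The object
-- type is a parameter here, so that two categories can have the same objects
-- by construction.
record CategoryOn {o} (V : Set o) (ℓ e : Level) : Set (o ⊔ suc (ℓ ⊔ e)) where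
  infix  4 _≈_ _⇒_
  infixr 9 _∘_
  field
    _⇒_       : V → V → Set ℓ
    _≈_       : ∀ {A B} → A ⇒ B → A ⇒ B → Set e
    id        : ∀ {A} → A ⇒ A
    _∘_       : ∀ {A B C} → B ⇒ C → A ⇒ B → A ⇒ C
    equiv     : ∀ {A B} → IsEquivalence (_≈_ {A} {B})
    assoc     : ∀ {A B C D} (h : C ⇒ D) (g : B ⇒ C) (f : A ⇒ B) →
                (h ∘ g) ∘ f ≈ h ∘ (g ∘ f)
    identityˡ : ∀ {A B} (f : A ⇒ B) → id ∘ f ≈ f
    identityʳ : ∀ {A B} (f : A ⇒ B) → f ∘ id ≈ f
    ∘-resp-≈  : ∀ {A B C} {g h : B ⇒ C} {f k : A ⇒ B} →
                g ≈ h → f ≈ k → g ∘ f ≈ h ∘ k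

record Category (o ℓ e : Level) : Set (suc (o ⊔ ℓ ⊔ e)) where
  field
    Obj        : Set o
    categoryOn : CategoryOn Obj ℓ e
  open CategoryOn categoryOn public

-- Functors into M whose action on objects is the given function F₀.
record FunctorOn {v ℓ e o′ ℓ′ e′} {V : Set v} (C : CategoryOn V ℓ e)
                 (M : Category o′ ℓ′ e′) (F₀ : V → Category.Obj M)
                 : Set (v ⊔ ℓ ⊔ e ⊔ ℓ′ ⊔ e′) where
  private
    module C = CategoryOn C
    module M = Category M
  field
    F₁           : ∀ {a b} → a C.⇒ b → F₀ a M.⇒ F₀ b
    F-resp-≈     : ∀ {a b} {f g : a C.⇒ b} → f C.≈ g → F₁ f M.≈ F₁ g
    identity     : ∀ {a} → F₁ (C.id {a}) M.≈ M.id
    homomorphism : ∀ {a b c} (g : b C.⇒ c) (f : a C.⇒ b) →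
                   F₁ (g C.∘ f) M.≈ F₁ g M.∘ F₁ f

record Functor {o ℓ e o′ ℓ′ e′} (C : Category o ℓ e) (M : Category o′ ℓ′ e′)
               : Set (o ⊔ ℓ ⊔ e ⊔ o′ ⊔ ℓ′ ⊔ e′) where
  field
    F₀        : Category.Obj C → Category.Obj M
    functorOn : FunctorOn (Category.categoryOn C) M F₀
  open FunctorOn functorOn public

record OpenMapSituation {o ℓ e} (M : Category o ℓ e) (v ℓ₁ e₁ ℓ₂ e₂ : Level)
                        : Set (o ⊔ ℓ ⊔ e ⊔ suc (v ⊔ ℓ₁ ⊔ e₁ ⊔ ℓ₂ ⊔ e₂)) where
  field
    V  : Set v
    J  : V → Category.Obj M
    𝔼  : CategoryOn V ℓ₁ e₁
    𝕊  : CategoryOn V ℓ₂ e₂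
    J𝔼 : FunctorOn 𝔼 M J
    J𝕊 : FunctorOn 𝕊 M J

module _ {o ℓ e v ℓ₁ e₁ ℓ₂ e₂} {M : Category o ℓ e}
         (O : OpenMapSituation M v ℓ₁ e₁ ℓ₂ e₂) where
  open Category M
  open OpenMapSituation O
  private
    module 𝔼  = CategoryOn 𝔼
    module 𝕊  = CategoryOn 𝕊
    module J𝔼 = FunctorOn J𝔼
    module J𝕊 = FunctorOn J𝕊

  IsGeneralizedOpen : ∀ {X Y} → X ⇒ Y → Set (ℓ ⊔ e ⊔ v ⊔ ℓ₁ ⊔ ℓ₂)
  IsGeneralizedOpen {X} {Y} f =
    ∀ {v w} (e : v 𝔼.⇒ w) (x : J v ⇒ X) (y : J w ⇒ Y) →
    y ∘ J𝔼.F₁ e ≈ f ∘ x →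
    Σ[ u ∈ V ] Σ[ e′ ∈ v 𝔼.⇒ u ] Σ[ s ∈ u 𝕊.⇒ w ] Σ[ x′ ∈ J u ⇒ X ]
      (J𝕊.F₁ s ∘ J𝔼.F₁ e′ ≈ J𝔼.F₁ e
       × x′ ∘ J𝔼.F₁ e′ ≈ x
       × f ∘ x′ ≈ y ∘ J𝕊.F₁ s)

module _ {o ℓ e o′ ℓ′ e′} {P : Category o ℓ e} {M : Category o′ ℓ′ e′}
         (J : Functor P M) where
  open Category M
  private
    module P = Category P
    module J = Functor J

  IsOpen : ∀ {X Y} → X ⇒ Y → Set (o ⊔ ℓ ⊔ ℓ′ ⊔ e′)
  IsOpen {X} {Y} f =
    ∀ {v w} (e : v P.⇒ w) (r : J.F₀ v ⇒ X) (s : J.F₀ w ⇒ Y) →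
    s ∘ J.F₁ e ≈ f ∘ r →
    Σ[ d ∈ J.F₀ w ⇒ X ] (f ∘ d ≈ s × d ∘ J.F₁ e ≈ r)

-- A morphism v ⇒ w is a proof of v ≡ w.  Axiom K is in force in this module,
-- so the only such morphisms are identities.
discrete : ∀ {v} (V : Set v) → CategoryOn V v v
discrete V = record
  { _⇒_       = _≡_
  ; _≈_       = _≡_
  ; id        = refl
  ; _∘_       = λ q p → trans p q
  ; equiv     = isEquivalence
  ; assoc     = λ { refl refl refl → refl }
  ; identityˡ = λ { refl → refl }
  ; identityʳ = λ { refl → refl }
  ; ∘-resp-≈  = λ q p → cong₂ trans p q
  }

module _ {v o ℓ e} {V : Set v} (M : Category o ℓ e)
         (J : V → Category.Obj M) where
  open Category M
  private module ≈ {A B} = IsEquivalence (equiv {A} {B})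

  discreteFunctor : FunctorOn (discrete V) M J
  discreteFunctor = record
    { F₁           = λ { refl → id }
    ; F-resp-≈     = λ { refl → ≈.refl }
    ; identity     = ≈.refl
    ; homomorphism = λ { refl refl → ≈.sym (identityˡ id) }
    }

  discreteFunctor-unique : (G : FunctorOn (discrete V) M J) →
    ∀ {a b} (p : a ≡ b) →
    FunctorOn.F₁ G p ≈ FunctorOn.F₁ discreteFunctor p
  discreteFunctor-unique G refl = FunctorOn.identity G

-- The situation (ℙ , |ℙ|).
discreteSituation : ∀ {o ℓ e o′ ℓ′ e′} {P : Category o ℓ e}
                    {M : Category o′ ℓ′ e′} →
                    Functor P M → OpenMapSituation M o ℓ e o o
discreteSituation {P = P} {M = M} J = record
  { V  = Category.Obj P
  ; J  = Functor.F₀ J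
  ; 𝔼  = Category.categoryOn P
  ; 𝕊  = discrete (Category.Obj P)
  ; J𝔼 = Functor.functorOn J
  ; J𝕊 = discreteFunctor M (Functor.F₀ J)
  }

{-# OPTIONS --safe #-}
module Submission where

open import Defs
open import Level using (Level)
open import Function.Bundles using (_⇔_; mk⇔)
open import Data.Product using (_,_)
open import Relation.Binary.Structures using (IsEquivalence)
open import Relation.Binary.PropositionalEquality using (refl)

-- Morphisms of the discrete category are identities, so in a generalized lift `u` is `w` and `s` is
-- sent to `id`. The three equations then say that `x′` is a diagonal filler, with `e′` in place of
-- `e`. Conversely, a filler `d` is a generalized lift with `e′ = e`.

module _ {o ℓ e o′ ℓ′ e′} {P : Category o ℓ e} {M : Category o′ ℓ′ e′}
         (J : Functor P M) where
  open Category M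
  private module ≈ {A B} = IsEquivalence (equiv {A} {B})

  open⇒generalizedOpen : ∀ {X Y} {f : X ⇒ Y} →
    IsOpen J f → IsGeneralizedOpen (discreteSituation J) f
  open⇒generalizedOpen f-open {w = w} e x y square
    with f-open e x y square
  ... | d , fd≈y , de≈x =
    w , e , refl , d ,
    identityˡ _ , de≈x , ≈.trans fd≈y (≈.sym (identityʳ y))

  generalizedOpen⇒open : ∀ {X Y} {f : X ⇒ Y} →
    IsGeneralizedOpen (discreteSituation J) f → IsOpen J f
  generalizedOpen⇒open f-open e r s square
    with f-open e r s square
  -- Matching `s` with `refl` makes its image under `discreteFunctor` compute to `id`.
  ... | _ , e′ , refl , x′ , id∘e′≈e , x′e′≈r , fx′≈s∘id =
    x′ , ≈.trans fx′≈s∘id (identityʳ s) ,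
    ≈.trans (∘-resp-≈ ≈.refl e≈e′) x′e′≈r
    where
    -- This equates only the images under `J`, in `M`; `e` and `e′` may differ in `P`.
    e≈e′ = ≈.trans (≈.sym id∘e′≈e) (identityˡ _)

proposition4p2 : ∀ {o ℓ e o′ ℓ′ e′ : Level} (P : Category o ℓ e) (M : Category o′ ℓ′ e′)
    (J : Functor P M) {X Y : Category.Obj M} (f : Category._⇒_ M X Y) →
    IsOpen J f ⇔ IsGeneralizedOpen (discreteSituation J) f
proposition4p2 P M J f = mk⇔ (open⇒generalizedOpen J) (generalizedOpen⇒open J)
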